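{- Let $n\ge1$. The involution $\tilde\vartheta=\varphi^{ -1}\circ\vartheta\circ\varphi:\mathcal P_n\to\mathcal P_n$ preserves the degree sequences and the statistic $\mathsf{rarm}$ and switches the statistics $\mathsf{larm}$ and $\mathsf{rev}$ (i.e. $\mathsf{larm}(\tilde\vartheta(T))=\mathsf{rev}(T)$ and $\mathsf{rev}(\tilde\vartheta(T))=\mathsf{larm}(T)$ for all $T\in\mathcal P_n$). In particular, $\mathsf{rev}$ interprets the Catalan triangle: for $1\le k\le n$, the number of $T\in\mathcal P_n$ with $\mathsf{rev}(T)=k$ equals $$C_{n,k}=\frac{k}{2n-k}\binom{2n-k}{n}.$$
   Context: **Plane and binary trees.** A plane tree is a rooted tree in which the children of each node are linearly ordered (left to right); $\mathcal P_n$ is the set of plane trees with $n$ edges. Nodes with the same parent are siblings; siblings to the left (right) of a node are its elder (younger) siblings. A binary tree is a rooted tree in which each node has at most one left child and at most one right child; $\mathcal B_n$ is the set of binary trees with $n$ nodes. The bijection $\varphi:\mathcal P_n\to\mathcal B_n$: the nodes of $\varphi(T)$ are the non-root nodes of $T$; its root is the leftmost child of the root of $T$; for non-root nodes $x,y$, $y$ is the left child of $x$ in $\varphi(T)$ iff $y$ is the leftmost child of $x$ in $T$, and $y$ is the right child of $x$ in $\varphi(T)$ iff $x$ is the closest elder sibling of $y$ in $T$. **The map $\vartheta:\mathcal B_n\to\mathcal B_n$.** Let $v_i$ be the $i$-th node of $B\in\mathcal B_n$ under the preorder (recursively: parent, left subtree, right subtree). Then $\vartheta(B)$ is the binary tree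 on the nodes $v_1,\dots,v_n$ with root $v_n$ such that, for $i$ from $n-1$ down to $1$: if $v_i$ has right child $v_\ell$ in $B$, then $v_i$ is the right child of $v_\ell$ in $\vartheta(B)$; otherwise $v_i$ is the left child of $v_{i+1}$ in $\vartheta(B)$. Trees are considered up to names of nodes. **Statistics of $T\in\mathcal P_n$.** - The degree of a node is its number of children; the degree sequence of $T$ is the multiset of degrees of all internal (non-leaf) nodes. - $\mathsf{larm}(T)$ is the number of edges of the left arm: the path starting at the root and going repeatedly to the leftmost child until a leaf is reached. $\mathsf{rarm}(T)$ is the number of edges of the right arm, defined in the same way with rightmost children. - Preorder on $T$: recursively visit the parent, then the subtrees of its children from left to right; the reverse preorder on $T$ is the reversal of the preorder. $\mathsf{rev}(T)$ is the number of nodes before the first node, under the reverse preorder, that has a younger sibling; by convention $\mathsf{rev}(T)=n$ if $T$ is the path with $n$ edges. -}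

module Defs where

open import Data.Bool.Base using (Bool; true; false; not; if_then_else_)
open import Data.Integer.Base using (+_)
open import Data.List.Base
  using (List; []; _∷_; _++_; length; null; reverse; filter; takeWhileᵇ)
open import Data.Maybe.Base using (Maybe; just; nothing; _<∣>_)
open import Data.Nat.Base
  using (ℕ; zero; suc; _+_; _*_; _∸_; _≤_; NonZero; >-nonZero)
open import Data.Nat.Combinatorics using (_C_)
open import Data.Nat.Properties
  using (_≟_; _≤?_; ≤-trans; m≤m+n; +-suc; +-identityʳ; +-∸-assoc)
open import Data.Rational.Base using (ℚ)
import Data.Rational.Base as ℚ
open import Data.Tree.Binary using (Tree; leaf; node; #nodes; mapₙ)
open import Data.Unit.Base using (⊤; tt)
open import Relation.Binary.PropositionalEquality
  using (_≡_; refl; cong; cong₂)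
open import Relation.Nullary.Decidable using (does)

data PlaneTree : Set where
  node : List PlaneTree → PlaneTree

mutual
  edges : PlaneTree → ℕ
  edges (node ts) = edgesᶠ ts

  edgesᶠ : List PlaneTree → ℕ
  edgesᶠ []       = 0
  edgesᶠ (t ∷ ts) = suc (edges t) + edgesᶠ ts

-- In both types below `leaf tt` is the empty tree (an absent child), so the
-- nodes of the tree are exactly the `node`s, counted by `#nodes`.

NamedBinaryTree : Set
NamedBinaryTree = Tree ℕ ⊤

BinaryTree : Set
BinaryTree = Tree ⊤ ⊤

forget : NamedBinaryTree → BinaryTree
forget = mapₙ (λ _ → tt)

-- φᶠ is applied to a node x = node cs together with its younger siblings ts:
-- the left child of x is the first element of cs (the leftmost child of x),
-- and the right child of x is the first element of ts (the node whose closest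
-- elder sibling is x). The root of a plane tree is discarded.

φᶠ : List PlaneTree → BinaryTree
φᶠ []             = leaf tt
φᶠ (node cs ∷ ts) = node (φᶠ cs) tt (φᶠ ts)

φ : PlaneTree → BinaryTree
φ (node ts) = φᶠ ts

φ⁻¹ᶠ : BinaryTree → List PlaneTree
φ⁻¹ᶠ (leaf _)     = []
φ⁻¹ᶠ (node l _ r) = node (φ⁻¹ᶠ l) ∷ φ⁻¹ᶠ r

φ⁻¹ : BinaryTree → PlaneTree
φ⁻¹ B = node (φ⁻¹ᶠ B)

φ⁻¹ᶠ∘φᶠ : ∀ ts → φ⁻¹ᶠ (φᶠ ts) ≡ ts
φ⁻¹ᶠ∘φᶠ []             = refl
φ⁻¹ᶠ∘φᶠ (node cs ∷ ts) =
  cong₂ (λ ds us → node ds ∷ us) (φ⁻¹ᶠ∘φᶠ cs) (φ⁻¹ᶠ∘φᶠ ts)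

φ⁻¹∘φ : ∀ T → φ⁻¹ (φ T) ≡ T
φ⁻¹∘φ (node ts) = cong node (φ⁻¹ᶠ∘φᶠ ts)

φ∘φ⁻¹ : ∀ B → φ (φ⁻¹ B) ≡ B
φ∘φ⁻¹ (leaf _)     = refl
φ∘φ⁻¹ (node l _ r) = cong₂ (λ l′ r′ → node l′ tt r′) (φ∘φ⁻¹ l) (φ∘φ⁻¹ r)

#nodes-φᶠ : ∀ ts → #nodes (φᶠ ts) ≡ edgesᶠ ts
#nodes-φᶠ []             = refl
#nodes-φᶠ (node cs ∷ ts)
  rewrite #nodes-φᶠ cs | #nodes-φᶠ ts = +-suc (edgesᶠ cs) (edgesᶠ ts)

#nodes-φ : ∀ T → #nodes (φ T) ≡ edges T
#nodes-φ (node ts) = #nodes-φᶠ ts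

-- preorderFrom i B gives the nodes of B the names i, i + 1, … in preorder, so
-- that in preorderFrom 1 B the name of the node vᵢ is i.

preorderFrom : ℕ → BinaryTree → NamedBinaryTree
preorderFrom i (leaf _)     = leaf tt
preorderFrom i (node l _ r) =
  node (preorderFrom (suc i) l) i (preorderFrom (suc (i + #nodes l)) r)

rootName : NamedBinaryTree → Maybe ℕ
rootName (leaf _)     = nothing
rootName (node _ x _) = just x

rightChildOf : ℕ → NamedBinaryTree → Maybe ℕ
rightChildOf i (leaf _)     = nothing
rightChildOf i (node l x r) =
  if does (x ≟ i) then rootName r else (rightChildOf i l <∣> rightChildOf i r)

single : ℕ → NamedBinaryTree
single c = node (leaf tt) c (leaf tt)

-- addLeft p c t makes a new node c the left child of the node p of t, and
-- addRight p c t makes it the right child. The place is meant to be vacant; a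
-- subtree already there would be overwritten. ϑ never does this: each of the
-- n − 1 additions creates at most one node, so ϑ(B) has n nodes only if
-- every addition finds its parent with the place vacant.

addLeft : ℕ → ℕ → NamedBinaryTree → NamedBinaryTree
addLeft p c (leaf _)     = leaf tt
addLeft p c (node l x r) =
  if does (x ≟ p) then node (single c) x r
                  else node (addLeft p c l) x (addLeft p c r)

addRight : ℕ → ℕ → NamedBinaryTree → NamedBinaryTree
addRight p c (leaf _)     = leaf tt
addRight p c (node l x r) =
  if does (x ≟ p) then node l x (single c)
                  else node (addRight p c l) x (addRight p c r)

module _ (B : NamedBinaryTree) where

  attach : ℕ → NamedBinaryTree → NamedBinaryTree
  attach i t with rightChildOf i B
  ... | just ℓ  = addRight ℓ i t
  ... | nothing = addLeft (suc i) i t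

  -- attachDown m t attaches m, m ∸ 1, …, 1 to t, in this order.
  attachDown : ℕ → NamedBinaryTree → NamedBinaryTree
  attachDown zero    t = t
  attachDown (suc m) t = attachDown m (attach (suc m) t)

ϑ : BinaryTree → BinaryTree
ϑ B with #nodes B
... | zero  = leaf tt
... | suc m = forget (attachDown (preorderFrom 1 B) m (single (suc m)))

ϑ̃ : PlaneTree → PlaneTree
ϑ̃ T = φ⁻¹ (ϑ (φ T))

mutual
  degrees : PlaneTree → List ℕ
  degrees (node ts) = length ts ∷ degreesᶠ ts

  degreesᶠ : List PlaneTree → List ℕ
  degreesᶠ []       = []
  degreesᶠ (t ∷ ts) = degrees t ++ degreesᶠ ts

-- A list standing for a multiset: to be compared up to permutation.
degreeSequence : PlaneTree → List ℕ
degreeSequence T = filter (1 ≤?_) (degrees T)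

larm : PlaneTree → ℕ
larm (node [])      = 0
larm (node (t ∷ _)) = suc (larm t)

mutual
  rarm : PlaneTree → ℕ
  rarm (node [])       = 0
  rarm (node (t ∷ ts)) = suc (rarmOfLast t ts)

  -- rarm of the last tree of the list t ∷ ts
  rarmOfLast : PlaneTree → List PlaneTree → ℕ
  rarmOfLast t []       = rarm t
  rarmOfLast _ (u ∷ us) = rarmOfLast u us

isPath : PlaneTree → Bool
isPath (node [])          = true
isPath (node (t ∷ []))    = isPath t
isPath (node (_ ∷ _ ∷ _)) = false

-- The nodes in preorder, each recorded as whether it has a younger sibling.

hasYoungerᶠ : List PlaneTree → List Bool
hasYoungerᶠ []             = []
hasYoungerᶠ (node cs ∷ ts) = not (null ts) ∷ hasYoungerᶠ cs ++ hasYoungerᶠ ts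

hasYounger : PlaneTree → List Bool
hasYounger (node ts) = false ∷ hasYoungerᶠ ts

rev : PlaneTree → ℕ
rev T = if isPath T then edges T
                    else length (takeWhileᵇ not (reverse (hasYounger T)))

2n∸k-nonZero : ∀ {n k} → 1 ≤ n → k ≤ n → NonZero (2 * n ∸ k)
2n∸k-nonZero {n} {k} 1≤n k≤n = >-nonZero (≤-trans 1≤n n≤2n∸k)
  where
  n≤2n∸k : n ≤ 2 * n ∸ k
  n≤2n∸k rewrite +-identityʳ n | +-∸-assoc n k≤n = m≤m+n n (n ∸ k)

fromℕ : ℕ → ℚ
fromℕ m = + m ℚ./ 1

catalanTriangle : (n k : ℕ) → 1 ≤ n → k ≤ n → ℚ
catalanTriangle n k 1≤n k≤n =
  (+ k ℚ./ (2 * n ∸ k)) ℚ.* fromℕ ((2 * n ∸ k) C n)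
  where
  instance
    _ : NonZero (2 * n ∸ k)
    _ = 2n∸k-nonZero 1≤n k≤n

{-# OPTIONS --safe #-}
module Submission where

open import Defs
open import Data.Bool.Base using (Bool; true; false; not; if_then_else_)
open import Data.Fin.Base using (Fin; zero)
open import Data.Fin.Properties using (+↔⊎)
import Data.Integer.Base as ℤ
import Data.Integer.Properties as ℤ
open import Data.List.Base using (List; []; _∷_; _++_; length; foldl; takeWhileᵇ)
open import Data.List.Properties using (++-identityʳ; ++-assoc; foldl-++)
open import Data.List.Relation.Binary.Permutation.Propositional
  using (_↭_; ↭-refl; ↭-sym; ↭-trans; prep; swap; module PermutationReasoning)
open import Data.List.Relation.Binary.Permutation.Propositional.Properties
  using (++⁺ˡ; ++⁺ʳ; shift; shifts; drop-∷; filter-↭; ∷↭∷ʳ)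
open import Data.Maybe.Base using (just; nothing)
open import Data.Nat.Base
  using (ℕ; zero; suc; _+_; _*_; _∸_; _≤_; _<_; z≤n; s≤s; NonZero)
open import Data.Nat.Combinatorics
  using (_C_; nCk≡nC[n∸k]; nCn≡1; nC1≡n; nCk+nC[k+1]≡[n+1]C[k+1])
open import Data.Nat.Combinatorics.Specification using (k>n⇒nCk≡0)
open import Data.Nat.Properties
open import Data.Nat.Tactic.RingSolver using (solve-∀)
open import Data.Product.Base using (Σ; Σ-syntax; ∃-syntax; _×_; _,_; proj₁)
import Data.Rational.Base as ℚ
open import Data.Rational.Properties using (toℚᵘ-injective; toℚᵘ-fromℚᵘ; toℚᵘ-homo-*)
open import Data.Rational.Unnormalised.Base using (mkℚᵘ; *≡*)
import Data.Rational.Unnormalised.Base as ℚᵘ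
import Data.Rational.Unnormalised.Properties as ℚᵘ
open import Data.Sum.Base using (_⊎_; inj₁; inj₂)
open import Data.Sum.Function.Propositional using (_⊎-↔_)
open import Data.Tree.Binary using (leaf; node; #nodes)
open import Data.Unit.Base using (tt)
open import Data.Vec.Base using (Vec; []; _∷_)
open import Function.Base using (_∘_; flip)
open import Function.Bundles using (_↔_; mk↔ₛ′)
open import Function.Construct.Composition using (_↔-∘_)
open import Function.Construct.Symmetry using (↔-sym)
open import Relation.Binary.PropositionalEquality
open import Relation.Nullary.Decidable using (dec-true; dec-false)

-- From the root of a nonempty binary tree B, go to the right child when there
-- is one and to the left child otherwise, until a leaf is reached. The steps of
-- this path, together with the left subtrees of the nodes left by a right step,
-- determine B, and ϑ reverses the sequence of steps while acting recursively on
-- those left subtrees. So ϑ is an involution. In φ⁻¹ B the path visits the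
-- children along the right arm: reversal keeps the number of left steps, which
-- gives rarm, and the lengths of the maximal runs of right steps, which give the
-- degrees on the right arm. The left steps before the first right step, followed
-- by the left arm of the subtree at that step, give larm; in the same way, rev is
-- read off from the end of the path. Finally, a tree with n edges
-- and larm k is a sequence of k plane forests with n − k edges in total, and these
-- are counted by the reflection principle.

pattern ∅ = leaf tt
pattern ● = node ∅ tt ∅

-- The map ϑ as the reversal of a path

-- As in the reversal of a list with an accumulator, X is already reversed.
mutual
  reflectOnto : BinaryTree → BinaryTree → BinaryTree
  reflectOnto (leaf _)                            X = X
  reflectOnto (node l _ r@(node _ _ _))           X = reflectOnto r (node (reflect l) tt X)
  reflectOnto (node (leaf _) _ (leaf _))          X = X
  reflectOnto (node l@(node _ _ _) _ (leaf _))    X = reflectOnto l (node X tt (leaf tt))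

  reflect : BinaryTree → BinaryTree
  reflect (leaf _)         = leaf tt
  reflect B@(node _ _ _)   = reflectOnto B (node (leaf tt) tt (leaf tt))

-- The same maps with the names given by ϑ; a is the name of the root of B, which
-- is also the root of X.
mutual
  reflectOntoᴺ : ℕ → BinaryTree → NamedBinaryTree → NamedBinaryTree
  reflectOntoᴺ a (leaf _)                         X = X
  reflectOntoᴺ a (node l _ r@(node _ _ _))        X =
    reflectOntoᴺ m r (node (reflectᴺ (suc a) l) m X)
    where m = suc (a + #nodes l)
  reflectOntoᴺ a (node (leaf _) _ (leaf _))       X = X
  reflectOntoᴺ a (node l@(node _ _ _) _ (leaf _)) X =
    reflectOntoᴺ (suc a) l (node X (suc a) (leaf tt))

  reflectᴺ : ℕ → BinaryTree → NamedBinaryTree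
  reflectᴺ a (leaf _)       = leaf tt
  reflectᴺ a B@(node _ _ _) = reflectOntoᴺ a B (single a)

mutual
  forget-reflectOntoᴺ : ∀ a B X →
    forget (reflectOntoᴺ a B X) ≡ reflectOnto B (forget X)
  forget-reflectOntoᴺ a (leaf _) X = refl
  forget-reflectOntoᴺ a (node l _ r@(node _ _ _)) X =
    trans (forget-reflectOntoᴺ (suc (a + #nodes l)) r _)
          (cong (λ t → reflectOnto r (node t tt (forget X)))
                (forget-reflectᴺ (suc a) l))
  forget-reflectOntoᴺ a (node (leaf _) _ (leaf _)) X = refl
  forget-reflectOntoᴺ a (node l@(node _ _ _) _ (leaf _)) X =
    forget-reflectOntoᴺ (suc a) l _

  forget-reflectᴺ : ∀ a B → forget (reflectᴺ a B) ≡ reflect B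
  forget-reflectᴺ a (leaf _)       = refl
  forget-reflectᴺ a B@(node _ _ _) = forget-reflectOntoᴺ a B (single a)

-- Attaching a node below a named node

data NonEmpty : BinaryTree → Set where
  nonEmpty : ∀ {l r} → NonEmpty (node l tt r)

data Side : Set where
  left right : Side

add : Side → ℕ → ℕ → NamedBinaryTree → NamedBinaryTree
add left  = addLeft
add right = addRight

-- That no node of the context K is named p is expressed by its effect: attaching
-- to p inside K X happens in X.
AvoidsName : ℕ → (NamedBinaryTree → NamedBinaryTree) → Set
AvoidsName p K = ∀ s c X → add s p c (K X) ≡ K (add s p c X)

∘-avoids : ∀ {p K D} → AvoidsName p K → AvoidsName p D → AvoidsName p (K ∘ D)
∘-avoids {K = K} avK avD s c X = trans (avK s c _) (cong K (avD s c X))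

add-node : ∀ s p c {l x r} → x ≢ p →
  add s p c (node l x r) ≡ node (add s p c l) x (add s p c r)
add-node left  p c {x = x} x≢p rewrite dec-false (x ≟ p) x≢p = refl
add-node right p c {x = x} x≢p rewrite dec-false (x ≟ p) x≢p = refl

add-leaf : ∀ s p c → add s p c (leaf tt) ≡ leaf tt
add-leaf left  p c = refl
add-leaf right p c = refl

addLeft-root : ∀ p c l r → addLeft p c (node l p r) ≡ node (single c) p r
addLeft-root p c _ _ rewrite dec-true (p ≟ p) refl = refl

addRight-root : ∀ p c l r → addRight p c (node l p r) ≡ node l p (single c)
addRight-root p c _ _ rewrite dec-true (p ≟ p) refl = refl

nodeLeft-avoids : ∀ {p x} → x ≢ p → AvoidsName p (λ X → node X x (leaf tt))
nodeLeft-avoids {p} x≢p s c X =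
  trans (add-node s p c x≢p) (cong (node _ _) (add-leaf s p c))

mutual
  -- Preorder gives the root of `B` its smallest name `a`, and this root already lies in `X`. So
  -- every node that `reflectOntoᴺ a B` builds around `X` has a name above `a`, including those of
  -- the reflected left subtrees.
  reflectOntoᴺ-avoids : ∀ {p} a B → p ≤ a → AvoidsName p (reflectOntoᴺ a B)
  reflectOntoᴺ-avoids a (leaf _) p≤a s c X = refl
  reflectOntoᴺ-avoids {p} a (node l _ r@(node _ _ _)) p≤a =
    ∘-avoids {K = reflectOntoᴺ m r} (reflectOntoᴺ-avoids m r (<⇒≤ p<m))
      λ s c X → trans (add-node s p c (>⇒≢ p<m))
                      (cong (λ t → node t m _) (add-reflectᴺ (suc a) l (s≤s p≤a) s c))
    where
    m   = suc (a + #nodes l)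
    p<m : p < m
    p<m = s≤s (m≤n⇒m≤n+o _ p≤a)
  reflectOntoᴺ-avoids a (node (leaf _) _ (leaf _)) p≤a s c X = refl
  reflectOntoᴺ-avoids a (node l@(node _ _ _) _ (leaf _)) p≤a =
    ∘-avoids {K = reflectOntoᴺ (suc a) l}
      (reflectOntoᴺ-avoids (suc a) l (m≤n⇒m≤1+n p≤a))
      (nodeLeft-avoids (>⇒≢ (s≤s p≤a)))

  add-reflectᴺ : ∀ {p} a B → p < a → ∀ s c → add s p c (reflectᴺ a B) ≡ reflectᴺ a B
  add-reflectᴺ a (leaf _) p<a s c = add-leaf s _ c
  add-reflectᴺ {p} a B@(node _ _ _) p<a s c =
    trans (reflectOntoᴺ-avoids a B (<⇒≤ p<a) s c (single a))
          (cong (reflectOntoᴺ a B)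
                (trans (add-node s p c (>⇒≢ p<a))
                       (cong₂ (λ l r → node l a r) (add-leaf s p c) (add-leaf s p c))))

-- Right children in the preorder numbering

rightChildOf-< : ∀ i a B → i < a → rightChildOf i (preorderFrom a B) ≡ nothing
rightChildOf-< i a (leaf _) i<a = refl
rightChildOf-< i a (node l _ r) i<a
  rewrite dec-false (a ≟ i) (>⇒≢ i<a)
        | rightChildOf-< i (suc a) l (m<n⇒m<1+n i<a)
        = rightChildOf-< i (suc (a + #nodes l)) r (m<n⇒m<1+n (m≤n⇒m≤n+o _ i<a))

start<end : ∀ {a b} (l r : BinaryTree) → a + #nodes (node l tt r) ≡ b → a < b
start<end {a} l r a+B≡b = subst (a <_) a+B≡b (m<m+n a (m≤n⇒m≤o+n (#nodes l) (s≤s z≤n)))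

-- Since `#nodes` counts a node as `#nodes l + suc (#nodes r)`, this re-expresses the end of its
-- interval of names from the start `suc (a + #nodes l)` of the right subtree.
a+[x+1+y]≡1+[a+x]+y : ∀ a x y → a + (x + suc y) ≡ suc (a + x) + y
a+[x+1+y]≡1+[a+x]+y a x y =
  trans (cong (a +_) (+-suc x y)) (trans (+-suc a _) (cong suc (sym (+-assoc a x y))))

rightChildOf-≥ : ∀ i a B → a + #nodes B ≤ i → rightChildOf i (preorderFrom a B) ≡ nothing
rightChildOf-≥ i a (leaf _) _ = refl
rightChildOf-≥ i a (node l _ r) end≤i
  with end≤i′ ← subst (_≤ i) (a+[x+1+y]≡1+[a+x]+y a (#nodes l) (#nodes r)) end≤i
  rewrite dec-false (a ≟ i) (<⇒≢ (≤-trans (s≤s (m≤n⇒m≤n+o (#nodes r) (m≤m+n a (#nodes l)))) end≤i′))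
        | rightChildOf-≥ i (suc a) l (≤-trans (m≤m+n _ (#nodes r)) end≤i′)
        = rightChildOf-≥ i (suc (a + #nodes l)) r end≤i′

module _ (B : NamedBinaryTree) where

  -- Only the right children matter to `attach`.
  record NamedSubtree (a : ℕ) (S : BinaryTree) : Set where
    constructor namedSubtree
    field
      rightChildOf-≡ : ∀ i → a ≤ i → i < a + #nodes S →
        rightChildOf i B ≡ rightChildOf i (preorderFrom a S)
  open NamedSubtree

  module _ {a l r} (sub : NamedSubtree a (node l tt r)) where

    private
      end : suc (a + #nodes l) + #nodes r ≡ a + #nodes {N = _} (node l tt r)
      end = sym (a+[x+1+y]≡1+[a+x]+y a (#nodes l) (#nodes r))

    rightChildOf-root : rightChildOf a B ≡ rootName (preorderFrom (suc (a + #nodes l)) r)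
    rightChildOf-root
      rewrite rightChildOf-≡ sub a ≤-refl (subst (a <_) end (s≤s (m≤n⇒m≤n+o _ (m≤m+n a _))))
            | dec-true (a ≟ a) refl = refl

    leftSubtree : NamedSubtree (suc a) l
    leftSubtree .rightChildOf-≡ i a<i i<end
      rewrite rightChildOf-≡ sub i (<⇒≤ a<i) (subst (i <_) end (m≤n⇒m≤n+o (#nodes r) i<end))
            | dec-false (a ≟ i) (<⇒≢ a<i)
            | rightChildOf-< i (suc (a + #nodes l)) r i<end
      -- The remaining `<∣> nothing` reduces only once the result of the lookup in `l` is known.
      with rightChildOf i (preorderFrom (suc a) l)
    ... | just _  = refl
    ... | nothing = refl

    rightSubtree : NamedSubtree (suc (a + #nodes l)) r
    rightSubtree .rightChildOf-≡ i m≤i i<end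
      rewrite rightChildOf-≡ sub i (≤-trans (m≤m+n a _) (<⇒≤ m≤i)) (subst (i <_) end i<end)
            | dec-false (a ≟ i) (<⇒≢ (≤-trans (s≤s (m≤m+n a _)) m≤i))
            | rightChildOf-≥ i (suc a) l m≤i = refl

  -- The path ends at the last node of `S` in preorder, and this node is a leaf. Hence `attach`
  -- makes the last node of a left subtree the left child of its successor, the root of the right
  -- subtree.
  rightChildOf-last : ∀ {a b} S → NamedSubtree (suc a) S → NonEmpty S →
    a + #nodes S ≡ b → rightChildOf b B ≡ nothing
  rightChildOf-last {a} (node l _ r@(node _ _ _)) sub _ a+S≡b =
    rightChildOf-last r (rightSubtree sub) nonEmpty
      (trans (sym (a+[x+1+y]≡1+[a+x]+y a (#nodes l) (#nodes r))) a+S≡b)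
  rightChildOf-last {a} (node (leaf _) _ (leaf _)) sub _ a+1≡b =
    trans (cong (λ i → rightChildOf i B) (trans (sym a+1≡b) (+-comm a 1))) (rightChildOf-root sub)
  rightChildOf-last {a} (node l@(node _ _ _) _ (leaf _)) sub _ a+S≡b =
    rightChildOf-last l (leftSubtree sub) nonEmpty
      (trans (sym (+-identityʳ _)) (trans (sym (a+[x+1+y]≡1+[a+x]+y a (#nodes l) 0)) a+S≡b))

  attach-left : ∀ {i} t → rightChildOf i B ≡ nothing → attach B i t ≡ addLeft (suc i) i t
  attach-left t eq rewrite eq = refl

  attach-right : ∀ {i j} t → rightChildOf i B ≡ just j → attach B i t ≡ addRight j i t
  attach-right t eq rewrite eq = refl

  -- The last node of S in preorder is attached first, and the nodes before it
  -- are attached inside the part of the tree grown from it.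
  attachDown-subtree : ∀ {a b} S K → NamedSubtree (suc a) S → NonEmpty S →
    a + #nodes S ≡ suc b → (∀ p → p ≤ suc b → AvoidsName p K) →
    attachDown B b (K (single (suc b))) ≡
    attachDown B a (K (reflectOntoᴺ (suc a) S (single (suc a))))
  attachDown-subtree {a} {b} (node l _ r@(node l₁ _ r₁)) K sub _ a+S≡ av =
    trans (attachDown-subtree r K (rightSubtree sub) nonEmpty a+r≡ av) (stepLeft l refl)
    where
    open ≡-Reasoning
    m = suc (suc a + #nodes l)
    a+r≡ : suc (a + #nodes l) + #nodes r ≡ suc b
    a+r≡ = trans (sym (a+[x+1+y]≡1+[a+x]+y a (#nodes l) (#nodes r))) a+S≡
    m≤b : m ≤ suc b
    m≤b = start<end l₁ r₁ a+r≡
    D = reflectOntoᴺ m r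
    KD-avoids : ∀ p → p ≤ m → AvoidsName p (K ∘ D)
    KD-avoids p p≤m = ∘-avoids {K = K} (av p (≤-trans p≤m m≤b)) (reflectOntoᴺ-avoids m r p≤m)
    -- The root of the subtree is named `suc a` and has right child `m`, so it fills the vacant
    -- right place of `m`.
    stepRight : ∀ t → attach B (suc a) (K (D (node t m (leaf tt)))) ≡
                      K (D (node t m (single (suc a))))
    stepRight t = begin
      attach B (suc a) (K (D (node t m (leaf tt))))
        ≡⟨ attach-right _ (rightChildOf-root sub) ⟩
      addRight m (suc a) (K (D (node t m (leaf tt))))
        ≡⟨ KD-avoids m ≤-refl right (suc a) _ ⟩
      K (D (addRight m (suc a) (node t m (leaf tt))))
        ≡⟨ cong (K ∘ D) (addRight-root m (suc a) t (leaf tt)) ⟩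
      K (D (node t m (single (suc a)))) ∎
    -- Between `m` and `suc a` come exactly the nodes of `l`. If there are any, the last one goes to
    -- the left of `m` and the induction grows the reflection of `l` there. The equation refines `l`
    -- inside `m` as well.
    stepLeft : ∀ l′ → l ≡ l′ →
      attachDown B (suc (a + #nodes l)) (K (D (single m))) ≡
      attachDown B a (K (D (node (reflectᴺ (suc (suc a)) l) m (single (suc a)))))
    stepLeft (leaf _) refl = trans
      (cong (λ x → attachDown B (suc x) (K (D (single m)))) (+-identityʳ a))
      (cong (attachDown B a) (stepRight (leaf tt)))
    stepLeft (node _ _ _) refl = begin
      attachDown B (a + #nodes l) (attach B (suc (a + #nodes l)) (K (D (single m))))
        ≡⟨ cong (attachDown B (a + #nodes l))
             (attach-left _ (rightChildOf-last l (leftSubtree sub) nonEmpty refl)) ⟩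
      attachDown B (a + #nodes l) (addLeft m (suc (a + #nodes l)) (K (D (single m))))
        ≡⟨ cong (attachDown B (a + #nodes l)) (KD-avoids m ≤-refl left _ _) ⟩
      attachDown B (a + #nodes l) (K (D (addLeft m (suc (a + #nodes l)) (single m))))
        ≡⟨ cong (attachDown B (a + #nodes l) ∘ K ∘ D) (addLeft-root m _ (leaf tt) (leaf tt)) ⟩
      attachDown B (a + #nodes l) (K (D (node (single (suc (a + #nodes l))) m (leaf tt))))
        ≡⟨ attachDown-subtree l (λ X → K (D (node X m (leaf tt)))) (leftSubtree sub) nonEmpty refl
             (λ p p≤ → ∘-avoids {K = K ∘ D} (KD-avoids p (m≤n⇒m≤1+n p≤))
                                            (nodeLeft-avoids (>⇒≢ (s≤s p≤)))) ⟩
      attachDown B a (attach B (suc a) (K (D (node (reflectᴺ (suc (suc a)) l) m (leaf tt)))))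
        ≡⟨ cong (attachDown B a) (stepRight _) ⟩
      attachDown B a (K (D (node (reflectᴺ (suc (suc a)) l) m (single (suc a))))) ∎
  attachDown-subtree {a} {b} (node (leaf _) _ (leaf _)) K sub _ a+S≡ av
    with refl ← suc-injective (trans (sym a+S≡) (+-comm a 1)) = refl
  attachDown-subtree {a} {b} (node l@(node l₁ _ r₁) _ (leaf _)) K sub _ a+S≡ av =
    trans (attachDown-subtree l K (leftSubtree sub) nonEmpty a+l≡ av)
          (cong (attachDown B a) step)
    where
    open ≡-Reasoning
    a+l≡ : suc a + #nodes l ≡ suc b
    a+l≡ = trans (sym (+-identityʳ _)) (trans (sym (a+[x+1+y]≡1+[a+x]+y a (#nodes l) 0)) a+S≡)
    D = reflectOntoᴺ (suc (suc a)) l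
    -- Without a right child, `suc a` goes to the left of `suc (suc a)`, the name of the root of
    -- `l`.
    step : attach B (suc a) (K (D (single (suc (suc a))))) ≡
           K (D (node (single (suc a)) (suc (suc a)) (leaf tt)))
    step = begin
      attach B (suc a) (K (D (single (suc (suc a)))))
        ≡⟨ attach-left _ (rightChildOf-root sub) ⟩
      addLeft (suc (suc a)) (suc a) (K (D (single (suc (suc a)))))
        ≡⟨ av (suc (suc a)) (start<end l₁ r₁ a+l≡) left (suc a) _ ⟩
      K (addLeft (suc (suc a)) (suc a) (D (single (suc (suc a)))))
        ≡⟨ cong K (reflectOntoᴺ-avoids (suc (suc a)) l ≤-refl left (suc a) _) ⟩
      K (D (addLeft (suc (suc a)) (suc a) (single (suc (suc a)))))
        ≡⟨ cong (K ∘ D) (addLeft-root (suc (suc a)) (suc a) (leaf tt) (leaf tt)) ⟩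
      K (D (node (single (suc a)) (suc (suc a)) (leaf tt))) ∎

ϑ≡reflect : ∀ B → ϑ B ≡ reflect B
ϑ≡reflect (leaf _) = refl
ϑ≡reflect B@(node _ _ _) = ϑ-nonEmpty B nonEmpty
  where
  ϑ-nonEmpty : ∀ B → NonEmpty B → ϑ B ≡ reflect B
  ϑ-nonEmpty B ne with #nodes B in #B≡
  ϑ-nonEmpty B@(node l _ r) ne | zero with () ← trans (sym #B≡) (+-suc (#nodes l) (#nodes r))
  ϑ-nonEmpty B@(node _ _ _) ne | suc m = trans
    -- The whole tree is taken with `a = 0` and the identity context, so nothing is left to attach
    -- afterwards.
    (cong forget (attachDown-subtree (preorderFrom 1 B) B (λ X → X)
      (namedSubtree (λ _ _ _ → refl)) ne #B≡ (λ _ _ _ _ _ → refl)))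
    (forget-reflectᴺ 1 B)

-- Involutivity

-- The counterpart of list concatenation: the last node of the path is replaced by `Y`, so that `●`
-- is a neutral element.
appendPath : BinaryTree → BinaryTree → BinaryTree
appendPath (leaf _)                      Y = Y
appendPath (node l _ r@(node _ _ _))     Y = node l tt (appendPath r Y)
appendPath (node (leaf _) _ (leaf _))    Y = Y
appendPath (node l@(node _ _ _) _ (leaf _)) Y = node (appendPath l Y) tt (leaf tt)

appendPath-● : ∀ B → NonEmpty B → appendPath B ● ≡ B
appendPath-● (node l _ r@(node _ _ _)) _ = cong (node l tt) (appendPath-● r nonEmpty)
appendPath-● (node (leaf _) _ (leaf _)) _ = refl
appendPath-● (node l@(node _ _ _) _ (leaf _)) _ =
  cong (λ t → node t tt ∅) (appendPath-● l nonEmpty)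

appendPath-nonEmpty : ∀ B {Y} → NonEmpty Y → NonEmpty (appendPath B Y)
appendPath-nonEmpty (leaf _) ne = ne
appendPath-nonEmpty (node l _ r@(node _ _ _)) ne = nonEmpty
appendPath-nonEmpty (node (leaf _) _ (leaf _)) ne = ne
appendPath-nonEmpty (node l@(node _ _ _) _ (leaf _)) ne = nonEmpty

reflectOnto-across : ∀ l {r X} → NonEmpty r →
  reflectOnto (node l tt r) X ≡ reflectOnto r (node (reflect l) tt X)
reflectOnto-across l nonEmpty = refl

reflectOnto-down : ∀ {l X} → NonEmpty l →
  reflectOnto (node l tt ∅) X ≡ reflectOnto l (node X tt ∅)
reflectOnto-down nonEmpty = refl

reflectOnto-nonEmpty : ∀ B {X} → NonEmpty X → NonEmpty (reflectOnto B X)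
reflectOnto-nonEmpty (leaf _) ne = ne
reflectOnto-nonEmpty (node l _ r@(node _ _ _)) ne = reflectOnto-nonEmpty r nonEmpty
reflectOnto-nonEmpty (node (leaf _) _ (leaf _)) ne = ne
reflectOnto-nonEmpty (node l@(node _ _ _) _ (leaf _)) ne = reflectOnto-nonEmpty l nonEmpty

reflect-nonEmpty : ∀ {B} → NonEmpty B → reflect B ≡ reflectOnto B ●
reflect-nonEmpty nonEmpty = refl

mutual
  -- The accumulator identity behind the involutivity of list reversal, with `appendPath` as
  -- concatenation. The left subtrees off the path of `B` are reflected twice, which the mutual
  -- induction undoes.
  reflectOnto-reflectOnto : ∀ B {X Y} → NonEmpty X → NonEmpty Y →
    reflectOnto (reflectOnto B X) Y ≡ reflectOnto X (appendPath B Y)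
  reflectOnto-reflectOnto (leaf _) _ _ = refl
  reflectOnto-reflectOnto (node l _ r@(node _ _ _)) {X} {Y} neX neY = begin
    reflectOnto (reflectOnto r (node (reflect l) tt X)) Y
      ≡⟨ reflectOnto-reflectOnto r nonEmpty neY ⟩
    reflectOnto (node (reflect l) tt X) (appendPath r Y)
      ≡⟨ reflectOnto-across (reflect l) neX ⟩
    reflectOnto X (node (reflect (reflect l)) tt (appendPath r Y))
      ≡⟨ cong (λ t → reflectOnto X (node t tt (appendPath r Y))) (reflect-involutive l) ⟩
    reflectOnto X (node l tt (appendPath r Y)) ∎
    where open ≡-Reasoning
  reflectOnto-reflectOnto (node (leaf _) _ (leaf _)) _ _ = refl
  reflectOnto-reflectOnto (node l@(node _ _ _) _ (leaf _)) neX neY =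
    trans (reflectOnto-reflectOnto l nonEmpty neY) (reflectOnto-down neX)

  reflect-involutive : ∀ B → reflect (reflect B) ≡ B
  reflect-involutive (leaf _) = refl
  reflect-involutive B@(node l _ r) = begin
    reflect (reflectOnto B ●)       ≡⟨ reflect-nonEmpty (reflectOnto-nonEmpty B nonEmpty) ⟩
    reflectOnto (reflectOnto B ●) ● ≡⟨ reflectOnto-reflectOnto B nonEmpty nonEmpty ⟩
    appendPath B ●                  ≡⟨ appendPath-● B nonEmpty ⟩
    B                               ∎
    where open ≡-Reasoning

mutual
  -- The root of `B` is also the root of `X`, so the sum on the right counts it twice.
  #nodes-reflectOnto : ∀ B X → NonEmpty B →
    suc (#nodes (reflectOnto B X)) ≡ #nodes B + #nodes X
  #nodes-reflectOnto (node l _ r@(node _ _ _)) X _ = begin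
    suc (#nodes (reflectOnto r (node (reflect l) tt X)))
      ≡⟨ #nodes-reflectOnto r _ nonEmpty ⟩
    #nodes r + (#nodes (reflect l) + suc (#nodes X))
      ≡⟨ cong (λ k → #nodes r + (k + suc (#nodes X))) (#nodes-reflect l) ⟩
    #nodes r + (#nodes l + suc (#nodes X))
      ≡⟨ cong (#nodes r +_) (+-suc (#nodes l) (#nodes X)) ⟩
    #nodes r + suc (#nodes l + #nodes X)
      ≡⟨ +-suc (#nodes r) _ ⟩
    suc (#nodes r + (#nodes l + #nodes X))
      ≡⟨ cong suc (+-assoc (#nodes r) (#nodes l) _) ⟨
    suc (#nodes r + #nodes l + #nodes X)
      ≡⟨ cong (λ k → suc (k + #nodes X)) (+-comm (#nodes r) (#nodes l)) ⟩
    suc (#nodes l + #nodes r + #nodes X)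
      ≡⟨ cong (_+ #nodes X) (+-suc (#nodes l) (#nodes r)) ⟨
    #nodes l + suc (#nodes r) + #nodes X ∎
    where open ≡-Reasoning
  #nodes-reflectOnto (node (leaf _) _ (leaf _)) X _ = refl
  #nodes-reflectOnto (node l@(node _ _ _) _ (leaf _)) X _ =
    trans (#nodes-reflectOnto l _ nonEmpty)
          (trans (cong (#nodes l +_) (+-comm (#nodes X) 1)) (sym (+-assoc (#nodes l) 1 (#nodes X))))

  #nodes-reflect : ∀ B → #nodes (reflect B) ≡ #nodes B
  #nodes-reflect (leaf _) = refl
  #nodes-reflect B@(node _ _ _) = suc-injective
    (trans (#nodes-reflectOnto B ● nonEmpty) (+-comm (#nodes B) 1))

-- Statistics

-- For a nonempty tree `rarm` is one more than the number of left steps of the path, and these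
-- numbers add up.
rarm-reflectOnto : ∀ B {X} → NonEmpty B → NonEmpty X →
  suc (rarm (φ⁻¹ (reflectOnto B X))) ≡ rarm (φ⁻¹ B) + rarm (φ⁻¹ X)
rarm-reflectOnto (node l _ r@(node _ _ _)) _ nonEmpty = rarm-reflectOnto r nonEmpty nonEmpty
rarm-reflectOnto (node (leaf _) _ (leaf _)) _ _ = refl
rarm-reflectOnto (node l@(node _ _ _) _ (leaf _)) {X} _ _ =
  trans (rarm-reflectOnto l nonEmpty nonEmpty) (+-suc (rarm (φ⁻¹ l)) (rarm (φ⁻¹ X)))

rarm-reflect : ∀ B → rarm (φ⁻¹ (reflect B)) ≡ rarm (φ⁻¹ B)
rarm-reflect (leaf _) = refl
rarm-reflect B@(node _ _ _) = suc-injective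
  (trans (rarm-reflectOnto B nonEmpty nonEmpty) (+-comm (rarm (φ⁻¹ B)) 1))

-- As a fold over a word: the length of its longest suffix without `true`.
falseRun : ℕ → Bool → ℕ
falseRun c b = if b then 0 else suc c

youngerᴮ : BinaryTree → List Bool
youngerᴮ = hasYoungerᶠ ∘ φ⁻¹ᶠ

mutual
  -- Here `c` is the run of `false` before the root of `B` is read, while the left arm of `X`
  -- already counts that root. A left step lengthens both by one. A right step resets both: the fold
  -- restarts at `0` on the left subtree, and the new left arm runs through the reflection of that
  -- subtree.
  larm-reflectOnto : ∀ B {X c} → NonEmpty B → larm (φ⁻¹ X) ≡ suc c →
    larm (φ⁻¹ (reflectOnto B X)) ≡ foldl falseRun c (hasYoungerᶠ (φ⁻¹ᶠ B))
  larm-reflectOnto (node l _ r@(node _ _ _)) {X} {c} _ eq = begin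
    larm (φ⁻¹ (reflectOnto r (node (reflect l) tt X)))
      ≡⟨ larm-reflectOnto r nonEmpty (cong suc (larm-reflect l)) ⟩
    foldl falseRun (foldl falseRun 0 (youngerᴮ l)) (youngerᴮ r)
      ≡⟨ foldl-++ falseRun 0 (youngerᴮ l) (youngerᴮ r) ⟨
    foldl falseRun 0 (youngerᴮ l ++ youngerᴮ r) ∎
    where open ≡-Reasoning
  larm-reflectOnto (node (leaf _) _ (leaf _)) _ eq = eq
  larm-reflectOnto (node l@(node _ _ _) _ (leaf _)) {X} {c} _ eq =
    trans (larm-reflectOnto l {c = suc c} nonEmpty (cong suc eq))
          (cong (foldl falseRun (suc c)) (sym (++-identityʳ (youngerᴮ l))))

  larm-reflect : ∀ B → larm (φ⁻¹ (reflect B)) ≡ foldl falseRun 0 (hasYoungerᶠ (φ⁻¹ᶠ B))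
  larm-reflect (leaf _) = refl
  larm-reflect B@(node _ _ _) = larm-reflectOnto B nonEmpty refl

-- List reversal is itself a left fold, and putting an entry in front of the accumulator changes its
-- initial run of `false` as `falseRun` does.
length-takeWhile-reverse : ∀ xs ys →
  length (takeWhileᵇ not (foldl (flip _∷_) ys xs)) ≡
  foldl falseRun (length (takeWhileᵇ not ys)) xs
length-takeWhile-reverse []           ys = refl
length-takeWhile-reverse (true  ∷ xs) ys = length-takeWhile-reverse xs (true ∷ ys)
length-takeWhile-reverse (false ∷ xs) ys = length-takeWhile-reverse xs (false ∷ ys)

falseRun-isPath : ∀ c ts → isPath (node ts) ≡ true →
  foldl falseRun c (hasYoungerᶠ ts) ≡ c + edgesᶠ ts
falseRun-isPath c []            _    = sym (+-identityʳ c)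
falseRun-isPath c (node cs ∷ []) path
  rewrite ++-identityʳ (hasYoungerᶠ cs)
        | falseRun-isPath (suc c) cs path
        | +-identityʳ (edgesᶠ cs)
        = sym (+-suc c (edgesᶠ cs))

falseRun-¬isPath : ∀ c d ts → isPath (node ts) ≡ false →
  foldl falseRun c (hasYoungerᶠ ts) ≡ foldl falseRun d (hasYoungerᶠ ts)
falseRun-¬isPath c d (node cs ∷ []) ¬path
  rewrite ++-identityʳ (hasYoungerᶠ cs) = falseRun-¬isPath (suc c) (suc d) cs ¬path
falseRun-¬isPath c d (node cs ∷ _ ∷ _) _ = refl

-- Leaving out the root makes the convention for paths a regular case: without any `true` the fold
-- counts the `n` non-root nodes. Otherwise the entry of the root only changes the start from `0` to
-- `1`, which is forgotten at the first `true`.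
rev≡falseRun : ∀ ts → rev (node ts) ≡ foldl falseRun 0 (hasYoungerᶠ ts)
rev≡falseRun ts with isPath (node ts) in path
... | true  = sym (falseRun-isPath 0 ts path)
... | false = trans (length-takeWhile-reverse (hasYounger (node ts)) [])
                    (falseRun-¬isPath 1 0 ts path)

degᴮ : BinaryTree → List ℕ
degᴮ = degreesᶠ ∘ φ⁻¹ᶠ

lenᴮ : BinaryTree → ℕ
lenᴮ = length ∘ φ⁻¹ᶠ

-- The first row of siblings on the path of B is merged with the row at the root
-- of X, whence j, and X takes the place of a leaf, whence the 0.
mutual
  degrees-reflectOnto : ∀ {j} B X → NonEmpty B → lenᴮ B + lenᴮ X ≡ suc j →
    0 ∷ degrees (φ⁻¹ (reflectOnto B X)) ↭ j ∷ degᴮ B ++ degᴮ X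
  degrees-reflectOnto {j} (node l _ r@(node _ _ _)) X _ eq = begin
    0 ∷ degrees (φ⁻¹ (reflectOnto r (node (reflect l) tt X)))
      ↭⟨ degrees-reflectOnto r _ nonEmpty (trans (+-suc (lenᴮ r) (lenᴮ X)) eq) ⟩
    j ∷ degᴮ r ++ degrees (φ⁻¹ (reflect l)) ++ degᴮ X
      ↭⟨ prep j (++⁺ˡ (degᴮ r) (++⁺ʳ (degᴮ X) (degrees-reflect l))) ⟩
    j ∷ degᴮ r ++ degrees (φ⁻¹ l) ++ degᴮ X
      ↭⟨ prep j (shifts (degᴮ r) (degrees (φ⁻¹ l))) ⟩
    j ∷ degrees (φ⁻¹ l) ++ degᴮ r ++ degᴮ X
      ≡⟨ cong (j ∷_) (++-assoc (degrees (φ⁻¹ l)) (degᴮ r) (degᴮ X)) ⟨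
    j ∷ (degrees (φ⁻¹ l) ++ degᴮ r) ++ degᴮ X ∎
    where open PermutationReasoning
  degrees-reflectOnto (node (leaf _) _ (leaf _)) X _ refl = swap 0 (lenᴮ X) ↭-refl
  degrees-reflectOnto (node l@(node _ _ _) _ (leaf _)) X _ refl = begin
    0 ∷ degrees (φ⁻¹ (reflectOnto l (node X tt ∅)))
      -- The root of `node X tt ∅` has no siblings, so merging gives a row of length `lenᴮ l`. The
      -- row of `X` moves below that root and contributes its length as a degree.
      ↭⟨ degrees-reflectOnto l _ nonEmpty (+-comm (lenᴮ l) 1) ⟩
    lenᴮ l ∷ degᴮ l ++ degrees (φ⁻¹ X) ++ []
      ≡⟨ cong (λ xs → lenᴮ l ∷ degᴮ l ++ xs) (++-identityʳ (degrees (φ⁻¹ X))) ⟩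
    degrees (φ⁻¹ l) ++ lenᴮ X ∷ degᴮ X
      ↭⟨ shift (lenᴮ X) (degrees (φ⁻¹ l)) (degᴮ X) ⟩
    lenᴮ X ∷ degrees (φ⁻¹ l) ++ degᴮ X
      ≡⟨ cong (λ xs → lenᴮ X ∷ xs ++ degᴮ X) (++-identityʳ (degrees (φ⁻¹ l))) ⟨
    lenᴮ X ∷ (degrees (φ⁻¹ l) ++ []) ++ degᴮ X ∎
    where open PermutationReasoning

  degrees-reflect : ∀ B → degrees (φ⁻¹ (reflect B)) ↭ degrees (φ⁻¹ B)
  degrees-reflect (leaf _) = ↭-refl
  degrees-reflect B@(node _ _ _) = drop-∷
    -- The degree list of `●` is a single `0`, which cancels the `0` on the left.
    (↭-trans (degrees-reflectOnto B ● nonEmpty (+-comm (lenᴮ B) 1))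
             (↭-sym (∷↭∷ʳ 0 (degrees (φ⁻¹ B)))))

-- Transfer to plane trees

module _ (T : PlaneTree) where

  private
    ϑ̃≡reflect : ϑ̃ T ≡ φ⁻¹ (reflect (φ T))
    ϑ̃≡reflect = cong φ⁻¹ (ϑ≡reflect (φ T))

  edges-ϑ̃ : edges (ϑ̃ T) ≡ edges T
  edges-ϑ̃ = begin
    edges (ϑ̃ T)                        ≡⟨ cong edges ϑ̃≡reflect ⟩
    edges (φ⁻¹ (reflect (φ T)))        ≡⟨ #nodes-φ (φ⁻¹ (reflect (φ T))) ⟨
    #nodes (φ (φ⁻¹ (reflect (φ T))))   ≡⟨ cong #nodes (φ∘φ⁻¹ (reflect (φ T))) ⟩
    #nodes (reflect (φ T))             ≡⟨ #nodes-reflect (φ T) ⟩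
    #nodes (φ T)                       ≡⟨ #nodes-φ T ⟩
    edges T                            ∎
    where open ≡-Reasoning

  ϑ̃-involutive : ϑ̃ (ϑ̃ T) ≡ T
  ϑ̃-involutive = begin
    ϑ̃ (ϑ̃ T)                              ≡⟨ cong ϑ̃ ϑ̃≡reflect ⟩
    φ⁻¹ (ϑ (φ (φ⁻¹ (reflect (φ T)))))    ≡⟨ cong (φ⁻¹ ∘ ϑ) (φ∘φ⁻¹ (reflect (φ T))) ⟩
    φ⁻¹ (ϑ (reflect (φ T)))              ≡⟨ cong φ⁻¹ (ϑ≡reflect (reflect (φ T))) ⟩
    φ⁻¹ (reflect (reflect (φ T)))        ≡⟨ cong φ⁻¹ (reflect-involutive (φ T)) ⟩
    φ⁻¹ (φ T)                            ≡⟨ φ⁻¹∘φ T ⟩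
    T                                    ∎
    where open ≡-Reasoning

  degrees-ϑ̃ : degrees (ϑ̃ T) ↭ degrees T
  degrees-ϑ̃ = begin
    degrees (ϑ̃ T)                  ≡⟨ cong degrees ϑ̃≡reflect ⟩
    degrees (φ⁻¹ (reflect (φ T)))  ↭⟨ degrees-reflect (φ T) ⟩
    degrees (φ⁻¹ (φ T))            ≡⟨ cong degrees (φ⁻¹∘φ T) ⟩
    degrees T                      ∎
    where open PermutationReasoning

  rarm-ϑ̃ : rarm (ϑ̃ T) ≡ rarm T
  rarm-ϑ̃ = begin
    rarm (ϑ̃ T)                  ≡⟨ cong rarm ϑ̃≡reflect ⟩
    rarm (φ⁻¹ (reflect (φ T)))  ≡⟨ rarm-reflect (φ T) ⟩
    rarm (φ⁻¹ (φ T))            ≡⟨ cong rarm (φ⁻¹∘φ T) ⟩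
    rarm T                      ∎
    where open ≡-Reasoning

  larm-ϑ̃ : larm (ϑ̃ T) ≡ rev T
  larm-ϑ̃ = begin
    larm (ϑ̃ T)                                          ≡⟨ cong larm ϑ̃≡reflect ⟩
    larm (φ⁻¹ (reflect (φ T)))                          ≡⟨ larm-reflect (φ T) ⟩
    foldl falseRun 0 (hasYoungerᶠ (φ⁻¹ᶠ (φ T)))         ≡⟨ rev≡falseRun (φ⁻¹ᶠ (φ T)) ⟨
    rev (φ⁻¹ (φ T))                                     ≡⟨ cong rev (φ⁻¹∘φ T) ⟩
    rev T                                               ∎
    where open ≡-Reasoning

rev-ϑ̃ : ∀ T → rev (ϑ̃ T) ≡ larm T
rev-ϑ̃ T = trans (sym (larm-ϑ̃ (ϑ̃ T))) (cong larm (ϑ̃-involutive T))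

-- Counting by larm

Σ-≡ : ∀ {A : Set} {P : A → Set} → (∀ {x} (p q : P x) → p ≡ q) →
  {u v : Σ A P} → proj₁ u ≡ proj₁ v → u ≡ v
Σ-≡ irr {x , p} {.x , q} refl = cong (x ,_) (irr p q)

×-irrelevant : ∀ {a b c d : ℕ} (p q : a ≡ b × c ≡ d) → p ≡ q
×-irrelevant (p , p′) (q , q′) = cong₂ _,_ (≡-irrelevant p q) (≡-irrelevant p′ q′)

totalEdges : ∀ {k} → Vec (List PlaneTree) k → ℕ
totalEdges []       = 0
totalEdges (ts ∷ v) = edgesᶠ ts + totalEdges v

Forests : ℕ → ℕ → Set
Forests k m = Σ[ v ∈ Vec (List PlaneTree) k ] totalEdges v ≡ m

-- Each forest supplies the younger siblings of one non-root node of the left arm, from the top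
-- down.
attachToArm : ∀ {k} → Vec (List PlaneTree) k → PlaneTree
attachToArm []       = node []
attachToArm (ts ∷ v) = node (attachToArm v ∷ ts)

larm-attachToArm : ∀ {k} (v : Vec (List PlaneTree) k) → larm (attachToArm v) ≡ k
larm-attachToArm []       = refl
larm-attachToArm (ts ∷ v) = cong suc (larm-attachToArm v)

edges-attachToArm : ∀ {k} (v : Vec (List PlaneTree) k) →
  edges (attachToArm v) ≡ k + totalEdges v
edges-attachToArm []               = refl
edges-attachToArm {suc k} (ts ∷ v) = cong suc (begin
  edges (attachToArm v) + edgesᶠ ts  ≡⟨ cong (_+ edgesᶠ ts) (edges-attachToArm v) ⟩
  k + totalEdges v + edgesᶠ ts       ≡⟨ +-assoc k _ _ ⟩
  k + (totalEdges v + edgesᶠ ts)     ≡⟨ cong (k +_) (+-comm (totalEdges v) _) ⟩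
  k + (edgesᶠ ts + totalEdges v)     ∎)
  where open ≡-Reasoning

detachFromArm : ∀ k T → larm T ≡ k → Vec (List PlaneTree) k
detachFromArm zero    (node [])       _  = []
detachFromArm (suc k) (node (t ∷ ts)) eq = ts ∷ detachFromArm k t (suc-injective eq)

attach-detach : ∀ k T (eq : larm T ≡ k) → attachToArm (detachFromArm k T eq) ≡ T
attach-detach zero    (node [])       _  = refl
attach-detach (suc k) (node (t ∷ ts)) eq =
  cong (λ u → node (u ∷ ts)) (attach-detach k t (suc-injective eq))

detach-attach : ∀ {k} (v : Vec (List PlaneTree) k) eq →
  detachFromArm k (attachToArm v) eq ≡ v
detach-attach []       _  = refl
detach-attach (ts ∷ v) eq = cong (ts ∷_) (detach-attach v (suc-injective eq))

larm-forests : ∀ k m →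
  (Σ[ T ∈ PlaneTree ] (edges T ≡ k + m × larm T ≡ k)) ↔ Forests k m
larm-forests k m = mk↔ₛ′ to from to∘from from∘to
  where
  to : Σ[ T ∈ PlaneTree ] (edges T ≡ k + m × larm T ≡ k) → Forests k m
  to (T , edges≡ , larm≡) = v , +-cancelˡ-≡ k _ _
    (trans (sym (edges-attachToArm v)) (trans (cong edges (attach-detach k T larm≡)) edges≡))
    where v = detachFromArm k T larm≡
  from : Forests k m → Σ[ T ∈ PlaneTree ] (edges T ≡ k + m × larm T ≡ k)
  from (v , total≡) =
    attachToArm v , trans (edges-attachToArm v) (cong (k +_) total≡) , larm-attachToArm v
  to∘from : ∀ x → to (from x) ≡ x
  to∘from (v , _) = Σ-≡ ≡-irrelevant (detach-attach v _)
  from∘to : ∀ x → from (to x) ≡ x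
  from∘to (T , _ , larm≡) = Σ-≡ ×-irrelevant (attach-detach k T larm≡)

forests-zero : ∀ k → Forests (suc k) 0 ↔ Forests k 0
forests-zero k = mk↔ₛ′ (λ { ([] ∷ v , eq) → v , eq }) (λ (v , eq) → [] ∷ v , eq)
                       (λ _ → refl) (λ { ([] ∷ v , eq) → refl })

-- An empty first forest is dropped. Otherwise the edge to its first tree is removed, which splits
-- this forest into the children of that tree's root and the remaining trees.
forests-suc : ∀ k m → Forests (suc k) (suc m) ↔ (Forests k (suc m) ⊎ Forests (suc (suc k)) m)
forests-suc k m = mk↔ₛ′ to from to∘from from∘to
  where
  to : Forests (suc k) (suc m) → Forests k (suc m) ⊎ Forests (suc (suc k)) m
  to ([] ∷ v , eq)             = inj₁ (v , eq)
  to ((node cs ∷ ts) ∷ v , eq) =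
    inj₂ (cs ∷ ts ∷ v , trans (sym (+-assoc (edgesᶠ cs) _ _)) (suc-injective eq))
  from : Forests k (suc m) ⊎ Forests (suc (suc k)) m → Forests (suc k) (suc m)
  from (inj₁ (v , eq))           = [] ∷ v , eq
  from (inj₂ (cs ∷ ts ∷ v , eq)) =
    (node cs ∷ ts) ∷ v , cong suc (trans (+-assoc (edgesᶠ cs) _ _) eq)
  to∘from : ∀ x → to (from x) ≡ x
  to∘from (inj₁ _)                = refl
  to∘from (inj₂ (_ ∷ _ ∷ _ , _)) = cong inj₂ (Σ-≡ ≡-irrelevant refl)
  from∘to : ∀ x → from (to x) ≡ x
  from∘to ([] ∷ _ , _)            = refl
  from∘to ((node _ ∷ _) ∷ _ , _) = Σ-≡ ≡-irrelevant refl

-- The coefficient of `x^m` in the `k`-th power of the Catalan generating function `c`; the last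
-- clause is `c^(k+1) = c^k + x c^(k+2)`.
#forests : ℕ → ℕ → ℕ
#forests zero    zero    = 1
#forests zero    (suc m) = 0
#forests (suc k) zero    = #forests k zero
#forests (suc k) (suc m) = #forests k (suc m) + #forests (suc (suc k)) m

forests-Fin : ∀ k m → Forests k m ↔ Fin (#forests k m)
forests-Fin zero    zero    = mk↔ₛ′ (λ _ → zero) (λ _ → [] , refl)
  (λ { zero → refl }) (λ { ([] , refl) → refl })
forests-Fin zero    (suc m) = mk↔ₛ′ (λ { ([] , ()) }) (λ ()) (λ ()) (λ { ([] , ()) })
forests-Fin (suc k) zero    = forests-Fin k zero ↔-∘ forests-zero k
forests-Fin (suc k) (suc m) =
  ↔-sym +↔⊎ ↔-∘ ((forests-Fin k (suc m) ⊎-↔ forests-Fin (suc (suc k)) m) ↔-∘ forests-suc k m)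

-- Closed formula for the number of forests

#forests-zero : ∀ k → #forests k 0 ≡ 1
#forests-zero zero    = refl
#forests-zero (suc k) = #forests-zero k

pascal : ∀ n k → suc n C suc k ≡ n C k + n C suc k
pascal n k = sym (nCk+nC[k+1]≡[n+1]C[k+1] n k)

nC0≡1 : ∀ n → n C 0 ≡ 1
nC0≡1 n = trans (nCk≡nC[n∸k] {0} {n} z≤n) (nCn≡1 n)

absorption : ∀ n k → suc k * (suc n C suc k) ≡ suc n * (n C k)
absorption n       zero    rewrite nC1≡n (suc n) | nC0≡1 n = *-comm 1 (suc n)
absorption zero    (suc k)
  rewrite k>n⇒nCk≡0 {1} {suc (suc k)} (s≤s (s≤s z≤n)) | k>n⇒nCk≡0 {0} {suc k} (s≤s z≤n)
        = *-zeroʳ (suc (suc k))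
absorption (suc n) (suc k) = begin
  suc (suc k) * (suc (suc n) C suc (suc k))
    ≡⟨ cong (suc (suc k) *_) (pascal (suc n) (suc k)) ⟩
  suc (suc k) * (a + b)
    ≡⟨ *-distribˡ-+ (suc (suc k)) a b ⟩
  a + suc k * a + suc (suc k) * b
    ≡⟨ cong₂ (λ x y → a + x + y) (absorption n k) (absorption n (suc k)) ⟩
  a + suc n * (n C k) + suc n * (n C suc k)
    ≡⟨ +-assoc a _ _ ⟩
  a + (suc n * (n C k) + suc n * (n C suc k))
    ≡⟨ cong (a +_) (*-distribˡ-+ (suc n) (n C k) _) ⟨
  a + suc n * (n C k + n C suc k)
    ≡⟨ cong (λ x → a + suc n * x) (pascal n k) ⟨
  suc (suc n) * (suc n C suc k) ∎
  where
  open ≡-Reasoning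
  a = suc n C suc k
  b = suc n C suc (suc k)

C-symmetric : ∀ m → suc (m + m) C m ≡ suc (m + m) C suc m
C-symmetric m = trans (nCk≡nC[n∸k] (m≤n⇒m≤1+n (m≤m+n m m)))
  (cong (suc (m + m) C_) (m+n∸n≡m (suc m) m))

-- The reflection principle, with the subtracted binomial moved to the left.
#forests-reflection : ∀ k m →
  #forests k (suc m) + suc (k + (m + m)) C m ≡ suc (k + (m + m)) C suc m
#forests-reflection zero    m = C-symmetric m
#forests-reflection (suc k) m = begin
  #forests k (suc m) + #forests (suc (suc k)) m + suc n C m
    ≡⟨ +-assoc (#forests k (suc m)) _ _ ⟩
  #forests k (suc m) + (#forests (suc (suc k)) m + suc n C m)
    ≡⟨ cong (#forests k (suc m) +_) (double m refl) ⟩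
  #forests k (suc m) + (n C m + n C m)
    ≡⟨ +-assoc (#forests k (suc m)) _ _ ⟨
  #forests k (suc m) + n C m + n C m
    ≡⟨ cong (_+ n C m) (#forests-reflection k m) ⟩
  n C suc m + n C m
    ≡⟨ +-comm (n C suc m) _ ⟩
  n C m + n C suc m
    ≡⟨ pascal n m ⟨
  suc n C suc m ∎
  where
  open ≡-Reasoning
  n = suc (k + (m + m))
  -- For `m = suc m′` the reflection formula at `suc (suc k)` and `m′` has the same upper index `n`.
  -- For `m = 0` every term is `1`.
  double : ∀ m′ → m ≡ m′ → #forests (suc (suc k)) m + suc n C m ≡ n C m + n C m
  double zero     refl rewrite #forests-zero k | nC0≡1 (suc n) | nC0≡1 n = refl
  double (suc m′) refl = begin
    #forests (suc (suc k)) (suc m′) + suc n C suc m′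
      ≡⟨ cong (#forests (suc (suc k)) (suc m′) +_) (pascal n m′) ⟩
    #forests (suc (suc k)) (suc m′) + (n C m′ + n C suc m′)
      ≡⟨ +-assoc (#forests (suc (suc k)) (suc m′)) _ _ ⟨
    #forests (suc (suc k)) (suc m′) + n C m′ + n C suc m′
      ≡⟨ cong (_+ n C suc m′)
           (subst (λ x → #forests (suc (suc k)) (suc m′) + x C m′ ≡ x C suc m′) (n≡ k m′)
                  (#forests-reflection (suc (suc k)) m′)) ⟩
    n C suc m′ + n C suc m′ ∎
    where
    n≡ : ∀ k m′ → suc (suc (suc k) + (m′ + m′)) ≡ suc (k + (suc m′ + suc m′))
    n≡ = solve-∀

-- With `N = k + 2(m + 1)`, the reflection formula is multiplied by `N`. Absorption turns the
-- subtracted term into `(m + 1) * (N C (m + 1))`; adding this term twice to both sides avoids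
-- subtraction, and `N - 2(m + 1) = k` remains as the factor.
#forests-formula : ∀ k m → (k + (m + m)) * #forests k m ≡ k * ((k + (m + m)) C m)
#forests-formula k zero
  rewrite #forests-zero k | nC0≡1 (k + 0) = cong (_* 1) (+-identityʳ k)
#forests-formula k (suc m) = subst (λ x → x * f ≡ k * (x C suc m)) (N≡ k m)
  (+-cancelʳ-≡ (suc m * (N C suc m)) (N * f) (k * (N C suc m))
  (+-cancelʳ-≡ (suc m * (N C suc m)) _ _ (begin
    N * f + suc m * (N C suc m) + suc m * (N C suc m)
      ≡⟨ cong (λ x → N * f + x + suc m * (N C suc m)) (absorption n m) ⟩
    N * f + N * (n C m) + suc m * (N C suc m)
      ≡⟨ cong (_+ suc m * (N C suc m)) (*-distribˡ-+ N f (n C m)) ⟨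
    N * (f + n C m) + suc m * (N C suc m)
      ≡⟨ cong₂ (λ x y → N * x + y) (#forests-reflection k m) (absorption n m) ⟩
    N * (n C suc m) + N * (n C m)
      ≡⟨ +-comm (N * (n C suc m)) _ ⟩
    N * (n C m) + N * (n C suc m)
      ≡⟨ *-distribˡ-+ N (n C m) _ ⟨
    N * (n C m + n C suc m)
      ≡⟨ cong (N *_) (pascal n m) ⟨
    N * (N C suc m)
      ≡⟨ split k m (N C suc m) ⟩
    k * (N C suc m) + suc m * (N C suc m) + suc m * (N C suc m) ∎)))
  where
  open ≡-Reasoning
  f = #forests k (suc m)
  n = suc (k + (m + m))
  N = suc n
  N≡ : ∀ k m → suc (suc (k + (m + m))) ≡ k + (suc m + suc m)
  N≡ = solve-∀
  split : ∀ k m c → suc (suc (k + (m + m))) * c ≡ k * c + suc m * c + suc m * c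
  split = solve-∀

-- For unnormalised rationals equality is cross multiplication, so the claim reduces to the equation
-- between natural numbers.
fromℕ≡/* : ∀ {a b c N} .{{_ : NonZero N}} → N * b ≡ a * c →
  fromℕ b ≡ (ℤ.+ a ℚ./ N) ℚ.* fromℕ c
fromℕ≡/* {a} {b} {c} {suc N} eq = toℚᵘ-injective (begin
  ℚ.toℚᵘ (fromℕ b)                             ≈⟨ toℚᵘ-fromℚᵘ (mkℚᵘ (ℤ.+ b) 0) ⟩
  mkℚᵘ (ℤ.+ b) 0                                 ≈⟨ *≡* cross ⟩
  mkℚᵘ (ℤ.+ a) N ℚᵘ.* mkℚᵘ (ℤ.+ c) 0
    ≈⟨ ℚᵘ.*-cong (toℚᵘ-fromℚᵘ (mkℚᵘ (ℤ.+ a) N)) (toℚᵘ-fromℚᵘ (mkℚᵘ (ℤ.+ c) 0)) ⟨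
  ℚ.toℚᵘ (ℤ.+ a ℚ./ suc N) ℚᵘ.* ℚ.toℚᵘ (fromℕ c) ≈⟨ toℚᵘ-homo-* (ℤ.+ a ℚ./ suc N) (fromℕ c) ⟨
  ℚ.toℚᵘ ((ℤ.+ a ℚ./ suc N) ℚ.* fromℕ c)         ∎)
  where
  open ℚᵘ.≃-Reasoning
  cross : ℤ.+ b ℤ.* ℤ.+ (suc N * 1) ≡ (ℤ.+ a ℤ.* ℤ.+ c) ℤ.* ℤ.+ 1
  cross = trans (cong (λ x → ℤ.+ b ℤ.* ℤ.+ x) (*-identityʳ (suc N)))
    (trans (sym (ℤ.pos-* b (suc N)))
    (trans (cong ℤ.+_ (trans (*-comm b (suc N)) eq))
    (trans (ℤ.pos-* a c) (sym (ℤ.*-identityʳ _)))))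

#forests≡catalanTriangle : ∀ n k (1≤n : 1 ≤ n) (k≤n : k ≤ n) →
  fromℕ (#forests k (n ∸ k)) ≡ catalanTriangle n k 1≤n k≤n
#forests≡catalanTriangle n k 1≤n k≤n = fromℕ≡/* {k} {f} {(2 * n ∸ k) C n} {{2n∸k-nonZero 1≤n k≤n}} (begin
  (2 * n ∸ k) * f                            ≡⟨ cong (_* f) N≡ ⟩
  (k + (m + m)) * f                          ≡⟨ #forests-formula k m ⟩
  -- The lower index `n` is the complement of `m` in `2 * n ∸ k = k + (m + m)`.
  k * ((k + (m + m)) C m)                    ≡⟨ cong (k *_) (nCk≡nC[n∸k] (m≤n⇒m≤o+n k (m≤m+n m m))) ⟩
  k * ((k + (m + m)) C (k + (m + m) ∸ m))    ≡⟨ cong₂ (λ N j → k * (N C j)) (sym N≡) n≡ ⟩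
  k * ((2 * n ∸ k) C n)                      ∎)
  where
  open ≡-Reasoning
  m = n ∸ k
  f = #forests k m
  k+m≡n : k + m ≡ n
  k+m≡n = m+[n∸m]≡n k≤n
  double : ∀ k m → 2 * (k + m) ≡ k + (k + (m + m))
  double = solve-∀
  N≡ : 2 * n ∸ k ≡ k + (m + m)
  N≡ = trans (cong (λ x → 2 * x ∸ k) (sym k+m≡n))
             (trans (cong (_∸ k) (double k m)) (m+n∸m≡n k (k + (m + m))))
  n≡ : k + (m + m) ∸ m ≡ n
  n≡ = trans (cong (_∸ m) (sym (+-assoc k m m))) (trans (m+n∸n≡m (k + m) m) k+m≡n)

-- Counting by rev

rev↔larm : ∀ n k →
  (Σ[ T ∈ PlaneTree ] (edges T ≡ n × rev T ≡ k)) ↔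
  (Σ[ T ∈ PlaneTree ] (edges T ≡ n × larm T ≡ k))
rev↔larm n k = mk↔ₛ′
  (λ (T , edges≡ , rev≡) → ϑ̃ T , trans (edges-ϑ̃ T) edges≡ , trans (larm-ϑ̃ T) rev≡)
  (λ (T , edges≡ , larm≡) → ϑ̃ T , trans (edges-ϑ̃ T) edges≡ , trans (rev-ϑ̃ T) larm≡)
  (λ (T , _) → Σ-≡ ×-irrelevant (ϑ̃-involutive T))
  (λ (T , _) → Σ-≡ ×-irrelevant (ϑ̃-involutive T))

rev-Fin : ∀ {n k} → k ≤ n →
  (Σ[ T ∈ PlaneTree ] (edges T ≡ n × rev T ≡ k)) ↔ Fin (#forests k (n ∸ k))
rev-Fin {n} {k} k≤n = forests-Fin k (n ∸ k) ↔-∘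
  (subst (λ x → (Σ[ T ∈ PlaneTree ] (edges T ≡ x × larm T ≡ k)) ↔ Forests k (n ∸ k))
         (m+[n∸m]≡n k≤n) (larm-forests k (n ∸ k))
   ↔-∘ rev↔larm n k)

proposition3p3 : (n : ℕ) (1≤n : 1 ≤ n) →
    ((T : PlaneTree) → edges T ≡ n →
    edges (ϑ̃ T) ≡ n
    × ϑ̃ (ϑ̃ T) ≡ T
    × degreeSequence (ϑ̃ T) ↭ degreeSequence T
    × rarm (ϑ̃ T) ≡ rarm T
    × larm (ϑ̃ T) ≡ rev T
    × rev (ϑ̃ T) ≡ larm T)
    × ((k : ℕ) → 1 ≤ k → (k≤n : k ≤ n) →
    ∃[ m ] ((Σ[ T ∈ PlaneTree ] (edges T ≡ n × rev T ≡ k)) ↔ Fin m)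
    × fromℕ m ≡ catalanTriangle n k 1≤n k≤n)
proposition3p3 n 1≤n =
  (λ T edges≡n →
      trans (edges-ϑ̃ T) edges≡n
    , ϑ̃-involutive T
    , filter-↭ (1 ≤?_) (degrees-ϑ̃ T)
    , rarm-ϑ̃ T
    , larm-ϑ̃ T
    , rev-ϑ̃ T)
  , λ k _ k≤n → #forests k (n ∸ k) , rev-Fin k≤n , #forests≡catalanTriangle n k 1≤n k≤n
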